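{- Let $r$ be a positive integer and $t\geq 2$ an integer. Let \[n_1=(6(t-1)-1)r+2,\qquad n_2=2(t-1)\binom{6(t-1)}{2}+3(t-1)(r+1)+1.\] Then every coloring of the edges of the complete bipartite graph $K_{n_1,n_2}$ with $r$ colors contains a monochromatic copy of $K_{2,t}$ or a rainbow copy of $K_{2,t}$.
   Context: A subgraph is monochromatic if all its edges have the same color, and rainbow if all its edges have pairwise distinct colors. -}

module Defs where

open import Data.Nat using (ℕ; _+_; _*_; _∸_)
open import Data.Nat.Combinatorics using (_C_)
open import Data.Fin using (Fin)
open import Data.Product using (_×_; ∃-syntax)
open import Data.Sum using (_⊎_)
open import Function using (flip)
open import Function.Definitions using (Injective)
open import Relation.Binary.PropositionalEquality using (_≡_)

-- An r-edge-coloring of the complete bipartite graph K_{m,n} with parts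
-- Fin m and Fin n: every edge {a , b} (a : Fin m, b : Fin n) gets a color.
Coloring : ℕ → ℕ → ℕ → Set
Coloring m n r = Fin m → Fin n → Fin r

-- An embedding of K_{2,t} into K_{m,n} with the 2-side inside the part Fin m
-- and the t-side inside the part Fin n (both vertex maps injective).
record Copy (m n t : ℕ) : Set where
  field
    left  : Fin 2 → Fin m
    right : Fin t → Fin n
    left-inj  : Injective _≡_ _≡_ left
    right-inj : Injective _≡_ _≡_ right

edgeColor : ∀ {m n r t} → Coloring m n r → Copy m n t → Fin 2 → Fin t → Fin r
edgeColor χ K i j = χ (Copy.left K i) (Copy.right K j)

Monochromatic : ∀ {m n r t} → Coloring m n r → Copy m n t → Set
Monochromatic {r = r} χ K = ∃[ c ] (∀ i j → edgeColor χ K i j ≡ c)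

Rainbow : ∀ {m n r t} → Coloring m n r → Copy m n t → Set
Rainbow χ K = ∀ i j i′ j′ → edgeColor χ K i j ≡ edgeColor χ K i′ j′ → (i ≡ i′ × j ≡ j′)

-- χ contains a copy of K_{2,t} (in either orientation) with property P
HasCopy : ∀ {m n r} (t : ℕ) → (∀ {a b} → Coloring a b r → Copy a b t → Set) →
          Coloring m n r → Set
HasCopy {m} {n} t P χ =
  (∃[ K ] P χ K) ⊎ (∃[ K ] P (flip χ) K)

n₁ : ℕ → ℕ → ℕ
n₁ r t = (6 * (t ∸ 1) ∸ 1) * r + 2

n₂ : ℕ → ℕ → ℕ
n₂ r t = 2 * (t ∸ 1) * ((6 * (t ∸ 1)) C 2) + 3 * (t ∸ 1) * (r + 1) + 1

{-# OPTIONS --safe #-}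
module Submission where

-- Write s = t - 1 and look only for copies whose 2-side lies in the part A of
-- size n₁. Without a monochromatic copy, any two vertices of A have at most s
-- common neighbours in each color. Call a vertex of A heavy in a color if it
-- has more than D = ⌈(C(6s,2) + r)/2⌉ edges of that color.
-- If two vertices are heavy in no color, a rainbow copy is built greedily: of
-- the n₂ vertices opposite, at most rs see both in one color and at most 4sD
-- repeat a color used before, and rs + 4sD < n₂.
-- Otherwise at least (6s-1)r + 1 vertices of A are heavy, so 6s of them are
-- heavy in a common color, and Bonferroni's inequality gives
-- 6s(D + 1) ≤ n₂ + s C(6s,2), which is false.

open import Defs
open import Data.Empty using (⊥-elim)
open import Data.Fin using (Fin; zero; suc)
open import Data.Fin.Patterns using (0F; 1F)
open import Data.Fin.Properties using (any?; suc-injective; 0≢1+n) renaming (_≟_ to _≟ᶠ_)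
open import Data.Nat using (ℕ; zero; suc; _+_; _*_; _∸_; _≤_; _<_; z≤n; s≤s; ⌊_/2⌋; ⌈_/2⌉; _<?_; _≟_; s≤s⁻¹)
open import Data.Nat.Combinatorics using (_C_; nC1≡n; nCk+nC[k+1]≡[n+1]C[k+1])
open import Data.Nat.Properties hiding (_≟_; _<?_; suc-injective; 0≢1+n)
open import Data.Nat.Tactic.RingSolver using (solve-∀)
open import Data.Product using (∃; ∃-syntax; _×_; _,_; proj₁; proj₂; map₂)
open import Data.Sum as Sum using (_⊎_; inj₁; inj₂)
open import Function using (_∘_)
open import Function.Definitions using (Injective)
open import Relation.Binary.PropositionalEquality using (_≡_; _≢_; refl; sym; trans; cong; subst)
open import Relation.Nullary using (¬_; Dec; yes; no; ¬?; _×-dec_)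
open import Relation.Unary using (Pred; Decidable)
open import Level using (0ℓ)

open import Algebra.Properties.CommutativeMonoid.Sum +-0-commutativeMonoid using (sum; sum-syntax; ∑-distrib-+; ∑-comm)

private
  variable
    k m n r s : ℕ

-- Counting by sums of indicators

𝟙 : {P : Set} → Dec P → ℕ
𝟙 (yes _) = 1
𝟙 (no _)  = 0

# : {P : Pred (Fin n) 0ℓ} → Decidable P → ℕ
# P? = sum (λ i → 𝟙 (P? i))

𝟙-true : {P : Set} (d : Dec P) → P → 1 ≤ 𝟙 d
𝟙-true (yes _) p = ≤-refl
𝟙-true (no ¬p) p = ⊥-elim (¬p p)

𝟙-false : {P : Set} (d : Dec P) → 𝟙 d ≡ 0 → ¬ P
𝟙-false (no ¬p) _ = ¬p

sum-mono-≤ : {f g : Fin n → ℕ} → (∀ i → f i ≤ g i) → sum f ≤ sum g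
sum-mono-≤ {zero}  f≤g = z≤n
sum-mono-≤ {suc n} f≤g = +-mono-≤ (f≤g zero) (sum-mono-≤ (f≤g ∘ suc))

sum-≤-* : {f : Fin n → ℕ} → (∀ i → f i ≤ s) → sum f ≤ n * s
sum-≤-* {zero}  f≤s = z≤n
sum-≤-* {suc n} f≤s = +-mono-≤ (f≤s zero) (sum-≤-* (f≤s ∘ suc))

sum-≥-* : {f : Fin n → ℕ} → (∀ i → s ≤ f i) → n * s ≤ sum f
sum-≥-* {zero}  s≤f = z≤n
sum-≥-* {suc n} s≤f = +-mono-≤ (s≤f zero) (sum-≥-* (s≤f ∘ suc))

term≤sum : (f : Fin n → ℕ) (i : Fin n) → f i ≤ sum f
term≤sum f zero    = m≤m+n (f zero) _
term≤sum f (suc i) = ≤-trans (term≤sum (f ∘ suc) i) (m≤n+m _ (f zero))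

sum≡0⇒term≡0 : (f : Fin n → ℕ) → sum f ≡ 0 → ∀ i → f i ≡ 0
sum≡0⇒term≡0 f eq i = n≤0⇒n≡0 (subst (f i ≤_) eq (term≤sum f i))

-- With `f` counting the obstructions at each vertex, an average below 1 leaves some vertex
-- unobstructed.
sum<n⇒zero : (f : Fin n → ℕ) → sum f < n → ∃[ i ] f i ≡ 0
sum<n⇒zero {n} f ∑f<n with any? (λ i → f i ≟ 0)
... | yes z = z
... | no ¬z = ⊥-elim (<⇒≱ ∑f<n (subst (_≤ sum f) (*-identityʳ n) (sum-≥-* λ i → n≢0⇒n>0 (λ eq → ¬z (i , eq)))))

-- Turns a bound on a count into actual vertices, by listing the first `k` members of `P` in
-- increasing order.
choose : {P : Pred (Fin n) 0ℓ} (P? : Decidable P) → k ≤ # P? →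
         ∃[ f ] (Injective _≡_ _≡_ f × (∀ (j : Fin k) → P (f j)))
choose {k = zero} P? _ = (λ ()) , (λ { {()} }) , (λ ())
choose {suc n} {suc k} P? k≤# with P? zero
... | yes p with f , f-inj , Pf ← choose (P? ∘ suc) (s≤s⁻¹ k≤#) =
  (λ { zero → zero ; (suc j) → suc (f j) }) ,
  (λ { {zero} {zero} _ → refl ; {suc i} {suc j} eq → cong suc (f-inj (suc-injective eq)) }) ,
  (λ { zero → p ; (suc j) → Pf j })
... | no _ with f , f-inj , Pf ← choose (P? ∘ suc) k≤# =
  suc ∘ f , f-inj ∘ suc-injective , Pf

C2-suc : ∀ k → k + k C 2 ≡ suc k C 2
C2-suc k = trans (cong (_+ k C 2) (sym (nC1≡n k))) (nCk+nC[k+1]≡[n+1]C[k+1] k 1)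

-- Induction on `k`: the new set meets each of the `k` earlier ones in at most `s` points, so it
-- adds all but `k * s` of its points to the union. These losses add up to
-- `s * (0 + 1 + ... + (k - 1))`.
bonferroni : {P : Fin k → Pred (Fin n) 0ℓ} (P? : ∀ i → Decidable (P i)) →
             (∀ {i j} → i ≢ j → # (λ b → P? i b ×-dec P? j b) ≤ s) →
             ∑[ i < k ] # (P? i) ≤ # (λ b → any? (λ i → P? i b)) + s * (k C 2)
bonferroni {zero} P? _ = z≤n
bonferroni {suc k} {n} {s} {P} P? P∩P≤s = begin
  # P₀? + ∑[ i < k ] # (P? (suc i))          ≤⟨ +-monoʳ-≤ (# P₀?) (bonferroni (P? ∘ suc) (λ i≢j → P∩P≤s (i≢j ∘ suc-injective))) ⟩
  # P₀? + (# U′? + s * (k C 2))              ≡⟨ +-assoc (# P₀?) (# U′?) _ ⟨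
  # P₀? + # U′? + s * (k C 2)                ≤⟨ +-monoˡ-≤ (s * (k C 2)) #P₀+#U′≤ ⟩
  # U? + k * s + s * (k C 2)                 ≡⟨ regroup (# U?) k s (k C 2) ⟩
  # U? + s * (k + k C 2)                     ≡⟨ cong (λ c → # U? + s * c) (C2-suc k) ⟩
  # U? + s * (suc k C 2)                     ∎
  where
  open ≤-Reasoning
  P₀? = P? zero
  U′? = λ b → any? (λ i → P? (suc i) b)
  U?  = λ b → any? (λ i → P? i b)
  ∩?  : ∀ b j → Dec (P zero b × P (suc j) b)
  ∩? b j = P₀? b ×-dec P? (suc j) b

  regroup : ∀ u k s c → u + k * s + s * c ≡ u + s * (k + c)
  regroup = solve-∀

  -- A point of both the new set and the union of the others counts twice on the left; the pairwise
  -- intersection containing it pays for the second count.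
  pointwise : ∀ b → 𝟙 (P₀? b) + 𝟙 (U′? b) ≤ 𝟙 (U? b) + ∑[ j < k ] 𝟙 (∩? b j)
  pointwise b = helper (P₀? b) (U′? b)
    where
    helper : (p : Dec (P zero b)) (u : Dec (∃[ i ] P (suc i) b)) →
             𝟙 p + 𝟙 u ≤ 𝟙 (U? b) + ∑[ j < k ] 𝟙 (∩? b j)
    helper (yes p) (yes (j , q)) = +-mono-≤ (𝟙-true (U? b) (zero , p))
      (≤-trans (𝟙-true (∩? b j) (p , q)) (term≤sum (λ j → 𝟙 (∩? b j)) j))
    helper (yes p) (no _)        = ≤-trans (𝟙-true (U? b) (zero , p)) (m≤m+n _ _)
    helper (no _)  (yes (j , q)) = ≤-trans (𝟙-true (U? b) (suc j , q)) (m≤m+n _ _)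
    helper (no _)  (no _)        = z≤n

  #P₀+#U′≤ : # P₀? + # U′? ≤ # U? + k * s
  #P₀+#U′≤ = begin
    # P₀? + # U′?                                      ≡⟨ ∑-distrib-+ (λ b → 𝟙 (P₀? b)) (λ b → 𝟙 (U′? b)) ⟨
    ∑[ b < n ] (𝟙 (P₀? b) + 𝟙 (U′? b))                 ≤⟨ sum-mono-≤ pointwise ⟩
    ∑[ b < n ] (𝟙 (U? b) + ∑[ j < k ] 𝟙 (∩? b j))      ≡⟨ ∑-distrib-+ (λ b → 𝟙 (U? b)) (λ b → ∑[ j < k ] 𝟙 (∩? b j)) ⟩
    # U? + ∑[ b < n ] ∑[ j < k ] 𝟙 (∩? b j)            ≡⟨ cong (# U? +_) (∑-comm (λ b j → 𝟙 (∩? b j))) ⟩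
    # U? + ∑[ j < k ] ∑[ b < n ] 𝟙 (∩? b j)            ≤⟨ +-monoʳ-≤ (# U?) (sum-≤-* (λ j → P∩P≤s {zero} {suc j} (λ ()))) ⟩
    # U? + k * s                                       ∎

-- Color degrees

degree : (Fin n → Fin r) → Fin r → ℕ
degree p c = # (λ b → p b ≟ᶠ c)

codegree : (Fin n → Fin r) → (Fin n → Fin r) → Fin r → ℕ
codegree p q c = # (λ b → (p b ≟ᶠ c) ×-dec (q b ≟ᶠ c))

-- A vertex where the rows agree is a common neighbor in the shared color, so the codegrees over all
-- `r` colors cover the agreements.
agreements≤ : (p q : Fin n → Fin r) → (∀ c → codegree p q c ≤ s) → # (λ b → p b ≟ᶠ q b) ≤ r * s
agreements≤ {n} {r} {s} p q codeg≤s = begin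
  # (λ b → p b ≟ᶠ q b)                    ≤⟨ sum-mono-≤ pointwise ⟩
  ∑[ b < n ] ∑[ c < r ] 𝟙 (both? b c)     ≡⟨ ∑-comm (λ b c → 𝟙 (both? b c)) ⟩
  ∑[ c < r ] codegree p q c               ≤⟨ sum-≤-* codeg≤s ⟩
  r * s                                   ∎
  where
  open ≤-Reasoning
  both? : ∀ b c → Dec (p b ≡ c × q b ≡ c)
  both? b c = (p b ≟ᶠ c) ×-dec (q b ≟ᶠ c)

  pointwise : ∀ b → 𝟙 (p b ≟ᶠ q b) ≤ ∑[ c < r ] 𝟙 (both? b c)
  pointwise b with p b ≟ᶠ q b
  ... | yes eq = ≤-trans (𝟙-true (both? b (q b)) (eq , refl)) (term≤sum (λ c → 𝟙 (both? b c)) (q b))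
  ... | no _   = z≤n

-- Building a rainbow copy: greedy extension and light vertices

RainbowAt : (Fin 2 → Fin n → Fin r) → (Fin k → Fin n) → Set
RainbowAt p f = ∀ i j i′ j′ → p i (f j) ≡ p i′ (f j′) → i ≡ i′ × j ≡ j′

cons : Fin n → (Fin k → Fin n) → Fin (suc k) → Fin n
cons b f zero    = b
cons b f (suc j) = f j

RainbowAt-cons : (p : Fin 2 → Fin n → Fin r) (f : Fin k → Fin n) (b : Fin n) →
                 p 0F b ≢ p 1F b → (∀ i i′ j → p i b ≢ p i′ (f j)) →
                 RainbowAt p f → RainbowAt p (cons b f)
RainbowAt-cons p f b b-proper b-new f-rainbow = rainbow
  where
  rainbow : RainbowAt p (cons b f)
  rainbow 0F zero 0F zero _ = refl , refl
  rainbow 0F zero 1F zero eq = ⊥-elim (b-proper eq)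
  rainbow 1F zero 0F zero eq = ⊥-elim (b-proper (sym eq))
  rainbow 1F zero 1F zero _ = refl , refl
  rainbow i zero i′ (suc j) eq = ⊥-elim (b-new i i′ j eq)
  rainbow i (suc j) i′ zero eq = ⊥-elim (b-new i′ i j (sym eq))
  rainbow i (suc j) i′ (suc j′) eq = map₂ (cong suc) (f-rainbow i j i′ j′ eq)

-- Each vertex chosen so far uses two colors, and each of these occurs at most `D` times in each of
-- the two rows, so it blocks at most `4D` vertices. When the last vertex is added, at most `s` have
-- been chosen, hence the factor `s`.
greedy-rainbow : ∀ {D} (p : Fin 2 → Fin n → Fin r) →
                 (∀ c → codegree (p 0F) (p 1F) c ≤ s) →
                 (∀ i c → degree (p i) c ≤ D) →
                 r * s + s * (2 * (2 * D)) < n →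
                 ∀ k → k ≤ suc s → ∃ λ (f : Fin k → Fin n) → RainbowAt p f
greedy-rainbow p codeg≤s deg≤D enough zero _ = (λ ()) , λ _ ()
greedy-rainbow {n} {r} {s} {D} p codeg≤s deg≤D enough (suc k) (s≤s k≤s)
  with f , f-rainbow ← greedy-rainbow p codeg≤s deg≤D enough k (m≤n⇒m≤1+n k≤s) =
  cons b f , RainbowAt-cons p f b b-proper b-new f-rainbow
  where
  open ≤-Reasoning
  agree repeats obstructions : Fin n → ℕ
  agree b = 𝟙 (p 0F b ≟ᶠ p 1F b)
  -- The used edge is given by `i′` and `j`, the new edge at `b` by `i`. Moving the sum over `b`
  -- innermost turns these counts into degrees.
  repeats b = ∑[ j < k ] ∑[ i′ < 2 ] ∑[ i < 2 ] 𝟙 (p i b ≟ᶠ p i′ (f j))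
  obstructions b = agree b + repeats b

  ∑repeats≤ : sum repeats ≤ k * (2 * (2 * D))
  ∑repeats≤ = begin
    sum repeats
      ≡⟨ ∑-comm (λ b j → ∑[ i′ < 2 ] ∑[ i < 2 ] 𝟙 (p i b ≟ᶠ p i′ (f j))) ⟩
    ∑[ j < k ] ∑[ b < n ] ∑[ i′ < 2 ] ∑[ i < 2 ] 𝟙 (p i b ≟ᶠ p i′ (f j))
      ≤⟨ sum-≤-* (λ j → begin
        ∑[ b < n ] ∑[ i′ < 2 ] ∑[ i < 2 ] 𝟙 (p i b ≟ᶠ p i′ (f j))
          ≡⟨ ∑-comm (λ b i′ → ∑[ i < 2 ] 𝟙 (p i b ≟ᶠ p i′ (f j))) ⟩
        ∑[ i′ < 2 ] ∑[ b < n ] ∑[ i < 2 ] 𝟙 (p i b ≟ᶠ p i′ (f j))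
          ≤⟨ sum-≤-* (λ i′ → begin
            ∑[ b < n ] ∑[ i < 2 ] 𝟙 (p i b ≟ᶠ p i′ (f j))
              ≡⟨ ∑-comm (λ b i → 𝟙 (p i b ≟ᶠ p i′ (f j))) ⟩
            ∑[ i < 2 ] degree (p i) (p i′ (f j))
              ≤⟨ sum-≤-* (λ i → deg≤D i (p i′ (f j))) ⟩
            2 * D ∎) ⟩
        2 * (2 * D) ∎) ⟩
    k * (2 * (2 * D)) ∎

  ∑obstructions<n : sum obstructions < n
  ∑obstructions<n = begin-strict
    sum obstructions                ≡⟨ ∑-distrib-+ agree repeats ⟩
    sum agree + sum repeats         ≤⟨ +-mono-≤ (agreements≤ (p 0F) (p 1F) codeg≤s) ∑repeats≤ ⟩
    r * s + k * (2 * (2 * D))       ≤⟨ +-monoʳ-≤ (r * s) (*-monoˡ-≤ (2 * (2 * D)) k≤s) ⟩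
    r * s + s * (2 * (2 * D))       <⟨ enough ⟩
    n                               ∎

  b = proj₁ (sum<n⇒zero obstructions ∑obstructions<n)

  unobstructed : obstructions b ≡ 0
  unobstructed = proj₂ (sum<n⇒zero obstructions ∑obstructions<n)

  b-proper : p 0F b ≢ p 1F b
  b-proper = 𝟙-false (p 0F b ≟ᶠ p 1F b) (m+n≡0⇒m≡0 (agree b) unobstructed)

  b-new : ∀ i i′ j → p i b ≢ p i′ (f j)
  b-new i i′ j = 𝟙-false (p i b ≟ᶠ p i′ (f j))
    (sum≡0⇒term≡0 (λ i → 𝟙 (p i b ≟ᶠ p i′ (f j)))
      (sum≡0⇒term≡0 (λ i′ → ∑[ i < 2 ] 𝟙 (p i b ≟ᶠ p i′ (f j)))
        (sum≡0⇒term≡0 (λ j → ∑[ i′ < 2 ] ∑[ i < 2 ] 𝟙 (p i b ≟ᶠ p i′ (f j)))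
          (m+n≡0⇒n≡0 (agree b) unobstructed) j) i′) i)

-- The relation `H` has at most `k * r` pairs, so at most that many rows are nonempty and at least
-- two of the `m` rows are empty.
pigeonhole-two : {H : Fin m → Fin r → Set} (H? : ∀ a c → Dec (H a c)) →
                 (∀ c → # (λ a → H? a c) ≤ k) → k * r + 2 ≤ m →
                 ∃ λ (f : Fin 2 → Fin m) → Injective _≡_ _≡_ f × (∀ i c → ¬ H (f i) c)
pigeonhole-two {m} {r} {k} H? col≤k enough =
  let f , f-inj , f-none = choose (λ a → row a ≟ 0) 2≤#
  in f , f-inj , λ i c → 𝟙-false (H? (f i) c) (sum≡0⇒term≡0 _ (f-none i) c)
  where
  open ≤-Reasoning
  row : Fin m → ℕ
  row a = ∑[ c < r ] 𝟙 (H? a c)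

  -- Every row contributes a pair or is counted as empty; summing over the rows bounds `m`.
  1≤ : ∀ x → 1 ≤ x + 𝟙 (x ≟ 0)
  1≤ zero    = ≤-refl
  1≤ (suc x) = s≤s z≤n

  2≤# : 2 ≤ # (λ a → row a ≟ 0)
  2≤# = +-cancelˡ-≤ (k * r) _ _ (begin
    k * r + 2                                 ≤⟨ enough ⟩
    m                                         ≡⟨ *-identityʳ m ⟨
    m * 1                                     ≤⟨ sum-≥-* (λ a → 1≤ (row a)) ⟩
    ∑[ a < m ] (row a + 𝟙 (row a ≟ 0))        ≡⟨ ∑-distrib-+ row (λ a → 𝟙 (row a ≟ 0)) ⟩
    sum row + # (λ a → row a ≟ 0)             ≡⟨ cong (_+ # (λ a → row a ≟ 0)) (∑-comm (λ a c → 𝟙 (H? a c))) ⟩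
    ∑[ c < r ] # (λ a → H? a c) + # (λ a → row a ≟ 0)
      ≤⟨ +-monoˡ-≤ (# (λ a → row a ≟ 0)) (≤-trans (sum-≤-* col≤k) (≤-reflexive (*-comm r k))) ⟩
    k * r + # (λ a → row a ≟ 0)               ∎)

-- The two kinds of copies

monochromatic-copy : (χ : Coloring m n r) {a a′ : Fin m} → a ≢ a′ → (c : Fin r) →
                     s < codegree (χ a) (χ a′) c → ∃[ K ] Monochromatic {t = suc s} χ K
monochromatic-copy {m} χ {a} {a′} a≢a′ c s<codeg
  with f , f-inj , f-mono ← choose (λ b → (χ a b ≟ᶠ c) ×-dec (χ a′ b ≟ᶠ c)) s<codeg =
  record { left = left ; right = f ; left-inj = left-inj ; right-inj = f-inj } ,
  c , λ { 0F j → proj₁ (f-mono j) ; 1F j → proj₂ (f-mono j) }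
  where
  left : Fin 2 → Fin m
  left 0F = a
  left 1F = a′

  left-inj : Injective _≡_ _≡_ left
  left-inj {0F} {0F} _  = refl
  left-inj {0F} {1F} eq = ⊥-elim (a≢a′ eq)
  left-inj {1F} {0F} eq = ⊥-elim (a≢a′ (sym eq))
  left-inj {1F} {1F} _  = refl

rainbow-copy : (χ : Coloring m n r) (left : Fin 2 → Fin m) → Injective _≡_ _≡_ left →
               (f : Fin k → Fin n) → RainbowAt (χ ∘ left) f → ∃[ K ] Rainbow {t = k} χ K
rainbow-copy χ left left-inj f f-rainbow =
  record { left = left ; right = f ; left-inj = left-inj
         -- Equal right vertices would give equally colored edges at `left 0F`, which the rainbow
         -- condition excludes for distinct indices.
         ; right-inj = λ {j} {j′} eq → proj₂ (f-rainbow 0F j 0F j′ (cong (χ (left 0F)) eq)) } ,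
  f-rainbow

-- The argument with free parameters: `D` is the threshold for being heavy, and `k` vertices cannot
-- all be heavy in one color. The three inequalities serve, in order, `pigeonhole-two`,
-- `greedy-rainbow` and the contradiction with `bonferroni`.
mono-or-rainbow : ∀ {D} (χ : Coloring m n r) →
                  (k ∸ 1) * r + 2 ≤ m →
                  r * s + s * (2 * (2 * D)) < n →
                  n + s * (k C 2) < k * suc D →
                  (∃[ K ] Monochromatic {t = suc s} χ K) ⊎ (∃[ K ] Rainbow {t = suc s} χ K)
mono-or-rainbow {m} {n} {r} {k} {s} {D} χ enough-left enough-right D-large
  with any? (λ a → any? (λ a′ → any? (λ c → ¬? (a ≟ᶠ a′) ×-dec (s <? codegree (χ a) (χ a′) c))))
... | yes (a , a′ , c , a≢a′ , s<codeg) = inj₁ (monochromatic-copy χ a≢a′ c s<codeg)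
... | no ¬large = inj₂ rainbow
  where
  codeg≤s : ∀ {a a′} → a ≢ a′ → ∀ c → codegree (χ a) (χ a′) c ≤ s
  codeg≤s {a} {a′} a≢a′ c = ≮⇒≥ λ s<codeg → ¬large (a , a′ , c , a≢a′ , s<codeg)

  heavy? : ∀ a c → Dec (D < degree (χ a) c)
  heavy? a c = D <? degree (χ a) c

  -- The color-`c` neighborhoods of `k` heavy vertices would have at least `D + 1` points each and
  -- pairwise overlaps of at most `s`, too much for `n` points.
  few-heavy : ∀ c → # (λ a → heavy? a c) < k
  few-heavy c = ≰⇒> λ k≤# → let
      open ≤-Reasoning
      f , f-inj , f-heavy = choose (λ a → heavy? a c) k≤#
      N? = λ i b → χ (f i) b ≟ᶠ c
    in <⇒≱ D-large (begin
      k * suc D                                              ≤⟨ sum-≥-* f-heavy ⟩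
      ∑[ i < k ] # (N? i)                                    ≤⟨ bonferroni N? (λ i≢j → codeg≤s (i≢j ∘ f-inj) c) ⟩
      # (λ b → any? (λ i → N? i b)) + s * (k C 2)            ≤⟨ +-monoˡ-≤ (s * (k C 2)) (#≤n (λ b → any? (λ i → N? i b))) ⟩
      n + s * (k C 2)                                        ∎)
    where
    𝟙≤1 : {P : Set} (d : Dec P) → 𝟙 d ≤ 1
    𝟙≤1 (yes _) = ≤-refl
    𝟙≤1 (no _)  = z≤n

    #≤n : {P : Pred (Fin n) 0ℓ} (P? : Decidable P) → # P? ≤ n
    #≤n P? = subst (# P? ≤_) (*-identityʳ n) (sum-≤-* (λ b → 𝟙≤1 (P? b)))

  rainbow : ∃[ K ] Rainbow {t = suc s} χ K
  rainbow =
    -- Fewer than `k` heavy vertices per color means at most `k ∸ 1`, the factor of `r` in the bound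
    -- on `m`.
    let left , left-inj , light = pigeonhole-two heavy? (λ c → ∸-monoˡ-≤ 1 (few-heavy c)) enough-left
        f , f-rainbow = greedy-rainbow (χ ∘ left) (codeg≤s (λ eq → 0≢1+n (left-inj eq)))
                          (λ i c → ≮⇒≥ (light i c)) enough-right (suc s) ≤-refl
    in rainbow-copy χ left left-inj f f-rainbow

-- Rounding and the numerical bounds

n≤2*⌈n/2⌉ : ∀ n → n ≤ 2 * ⌈ n /2⌉
n≤2*⌈n/2⌉ n = begin
  n                        ≡⟨ ⌊n/2⌋+⌈n/2⌉≡n n ⟨
  ⌊ n /2⌋ + ⌈ n /2⌉        ≤⟨ +-mono-≤ (⌊n/2⌋≤⌈n/2⌉ n) (m≤m+n ⌈ n /2⌉ 0) ⟩
  2 * ⌈ n /2⌉              ∎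
  where open ≤-Reasoning

2*⌈n/2⌉≤1+n : ∀ n → 2 * ⌈ n /2⌉ ≤ suc n
2*⌈n/2⌉≤1+n n = begin
  ⌈ n /2⌉ + (⌈ n /2⌉ + 0)          ≡⟨ cong (⌈ n /2⌉ +_) (+-identityʳ _) ⟩
  ⌈ n /2⌉ + ⌈ n /2⌉                ≤⟨ +-monoʳ-≤ ⌈ n /2⌉ (⌊n/2⌋≤⌈n/2⌉ (suc n)) ⟩
  ⌊ suc n /2⌋ + ⌈ suc n /2⌉        ≡⟨ ⌊n/2⌋+⌈n/2⌉≡n (suc n) ⟩
  suc n                            ∎
  where open ≤-Reasoning

theorem3 : (r t : ℕ) → 1 ≤ r → 2 ≤ t → (χ : Coloring (n₁ r t) (n₂ r t) r) →
    HasCopy t Monochromatic χ ⊎ HasCopy t Rainbow χ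
theorem3 r (suc s@(suc s′)) _ (s≤s (s≤s _)) χ =
  Sum.map inj₁ inj₁ (mono-or-rainbow {k = 6 * s} χ ≤-refl enough-right D-large)
  where
  open ≤-Reasoning
  c = (6 * s) C 2
  -- Half of `c + r` balances two demands: the greedy choice needs `2 * D` at most `c + r + 1`,
  -- Bonferroni needs it at least `c + r`.
  D = ⌈ c + r /2⌉

  split-right : ∀ s r c → 2 * s * c + 3 * s * (r + 1) + 1 ≡ suc (r * s + s * (2 * suc (c + r)) + s)
  split-right = solve-∀

  enough-right : r * s + s * (2 * (2 * D)) < n₂ r (suc s)
  enough-right = begin-strict
    r * s + s * (2 * (2 * D))               ≤⟨ +-monoʳ-≤ (r * s) (*-monoʳ-≤ s (*-monoʳ-≤ 2 (2*⌈n/2⌉≤1+n (c + r)))) ⟩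
    r * s + s * (2 * suc (c + r))           ≤⟨ m≤m+n _ s ⟩
    r * s + s * (2 * suc (c + r)) + s       <⟨ n<1+n _ ⟩
    suc (r * s + s * (2 * suc (c + r)) + s) ≡⟨ split-right s r c ⟨
    n₂ r (suc s)                            ∎

  -- The surplus is `3s - 2`, positive because `t` is at least 2; writing `s` as `suc s′` avoids
  -- subtraction.
  split-large : ∀ s′ r c → let s = suc s′ in
    3 * s * (c + r) + 6 * s ≡ suc (2 * s * c + 3 * s * (r + 1) + 1 + s * c) + (3 * s′ + 1)
  split-large = solve-∀

  D-large : n₂ r (suc s) + s * c < 6 * s * suc D
  D-large = begin
    suc (n₂ r (suc s) + s * c)                  ≤⟨ m≤m+n _ (3 * s′ + 1) ⟩
    suc (n₂ r (suc s) + s * c) + (3 * s′ + 1)   ≡⟨ split-large s′ r c ⟨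
    3 * s * (c + r) + 6 * s                     ≤⟨ +-monoˡ-≤ (6 * s) (*-monoʳ-≤ (3 * s) (n≤2*⌈n/2⌉ (c + r))) ⟩
    3 * s * (2 * D) + 6 * s                     ≡⟨ regroup s D ⟩
    6 * s * suc D                               ∎
    where
    regroup : ∀ s D → 3 * s * (2 * D) + 6 * s ≡ 6 * s * suc D
    regroup = solve-∀
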